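{- For every integer $n \ge 1$ there exists a maximal distinct pair-sum (dps) polytope in $\mathbb{R}^n$, i.e. a dps polytope $\mathcal{P} \subset \mathbb{R}^n$ with $N(\mathcal{P}) = |\mathcal{P}\cap\mathbb{Z}^n| = 2^n$.
   Context: A lattice polytope $\mathcal{P}$ in $\mathbb{R}^n$ is the convex hull of a finite subset of $\mathbb{Z}^n$. Write $\mathcal{L}(\mathcal{P}) := \mathcal{P} \cap \mathbb{Z}^n = \{v_1,\dots,v_N\}$, where $N = N(\mathcal{P}) := |\mathcal{L}(\mathcal{P})|$. The lattice polytope $\mathcal{P}$ is called a distinct pair-sum (dps) polytope if the $N + \binom{N}{2}$ sums $2v_1,\dots,2v_N$ and $v_i+v_j$ ($1 \le i<j\le N$) are all distinct, i.e. $v_i + v_j = v_k + v_\ell$ implies $\{i,j\}=\{k,\ell\}$ as multisets. A dps polytope $\mathcal{P}\subset\mathbb{R}^n$ is called maximal if $N(\mathcal{P}) = 2^n$. -}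

module Defs where

open import Algebra.Bundles.Raw using (RawMonoid)
import Algebra.Definitions.RawMonoid as RawMonoidDefs
open import Data.Fin using (Fin)
open import Data.Integer as ℤ using (ℤ)
open import Data.Nat as ℕ using (ℕ)
import Data.Nat.Properties as ℕₚ
open import Data.Product using (Σ; ∃; ∃₂; _×_; _,_)
open import Data.Rational as ℚ using (ℚ; 0ℚ; 1ℚ; ½)
import Data.Rational.Properties as ℚₚ
open import Data.Rational.Solver using (module +-*-Solver)
open import Data.Sum using (_⊎_)
open import Data.Vec using (Vec; lookup; zipWith)
open import Data.Vec.Functional using (Vector; map)
open import Function.Base using (case_of_)
open import Function.Bundles using (_⇔_)
open import Function.Definitions using (Injective)
open import Level using (0ℓ)
open import Relation.Binary.PropositionalEquality using (_≡_; refl; sym; cong; cong₂; subst)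
open import Relation.Unary using (Pred; _∈_; _≐_)

-- The real numbers, as Cauchy sequences of rationals up to _≈_.

IsCauchy : (ℕ → ℚ) → Set
IsCauchy x = ∀ ε → 0ℚ ℚ.< ε →
  ∃ λ N → ∀ m n → N ℕ.≤ m → N ℕ.≤ n → ℚ.∣ x m ℚ.- x n ∣ ℚ.≤ ε

record ℝ : Set where
  constructor mkℝ
  field
    seq    : ℕ → ℚ
    cauchy : IsCauchy seq

open ℝ public

infix  4 _≈_ _≤_
infixl 6 _+_
infixl 7 _*_

_≈_ : ℝ → ℝ → Set
x ≈ y = ∀ ε → 0ℚ ℚ.< ε →
  ∃ λ N → ∀ n → N ℕ.≤ n → ℚ.∣ seq x n ℚ.- seq y n ∣ ℚ.≤ ε

_≤_ : ℝ → ℝ → Set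
x ≤ y = ∀ ε → 0ℚ ℚ.< ε →
  ∃ λ N → ∀ n → N ℕ.≤ n → seq x n ℚ.≤ seq y n ℚ.+ ε

fromℚ : ℚ → ℝ
fromℚ q = mkℝ (λ _ → q) λ ε 0<ε → 0 , λ _ _ _ _ →
  subst (ℚ._≤ ε) (sym (cong ℚ.∣_∣ (ℚₚ.+-inverseʳ q))) (ℚₚ.<⇒≤ 0<ε)

fromℤ : ℤ → ℝ
fromℤ k = fromℚ (k ℚ./ 1)

0ℝ 1ℝ : ℝ
0ℝ = fromℚ 0ℚ
1ℝ = fromℚ 1ℚ

halve : ∀ ε → 0ℚ ℚ.< ε → ∃ λ δ → 0ℚ ℚ.< δ × δ ℚ.+ δ ≡ ε
halve ε 0<ε
  = ½ ℚ.* ε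
  , ℚₚ.positive⁻¹ (½ ℚ.* ε) {{ℚₚ.pos*pos⇒pos ½ ε {{ℚ.positive 0<ε}}}}
  , solve 1 (λ e → con ½ :* e :+ con ½ :* e := e) refl ε
  where open +-*-Solver

abstract

  +-cauchy : ∀ {x y} → IsCauchy x → IsCauchy y → IsCauchy (λ n → x n ℚ.+ y n)
  +-cauchy {x} {y} cx cy ε 0<ε =
    case halve ε 0<ε of λ (δ , 0<δ , δ+δ≡ε) →
    case cx δ 0<δ of λ (M , p) →
    case cy δ 0<δ of λ (N , q) →
    M ℕ.⊔ N , λ m n M⊔N≤m M⊔N≤n → begin
      ℚ.∣ (x m ℚ.+ y m) ℚ.- (x n ℚ.+ y n) ∣
        ≡⟨ cong ℚ.∣_∣ (rearrange (x m) (y m) (x n) (y n)) ⟩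
      ℚ.∣ (x m ℚ.- x n) ℚ.+ (y m ℚ.- y n) ∣
        ≤⟨ ℚₚ.∣p+q∣≤∣p∣+∣q∣ (x m ℚ.- x n) (y m ℚ.- y n) ⟩
      ℚ.∣ x m ℚ.- x n ∣ ℚ.+ ℚ.∣ y m ℚ.- y n ∣
        ≤⟨ ℚₚ.+-mono-≤ (p m n (ℕₚ.m⊔n≤o⇒m≤o M N M⊔N≤m) (ℕₚ.m⊔n≤o⇒m≤o M N M⊔N≤n))
                       (q m n (ℕₚ.m⊔n≤o⇒n≤o M N M⊔N≤m) (ℕₚ.m⊔n≤o⇒n≤o M N M⊔N≤n)) ⟩
      δ ℚ.+ δ
        ≡⟨ δ+δ≡ε ⟩
      ε ∎
    where
    open ℚₚ.≤-Reasoning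
    open +-*-Solver
    rearrange : ∀ a b c d → (a ℚ.+ b) ℚ.- (c ℚ.+ d) ≡ (a ℚ.- c) ℚ.+ (b ℚ.- d)
    rearrange = solve 4 (λ a b c d → (a :+ b) :- (c :+ d) := (a :- c) :+ (b :- d)) refl

  eventuallyBounded : ∀ {x} → IsCauchy x →
    ∃₂ λ N B → ℚ.Positive B × (∀ n → N ℕ.≤ n → ℚ.∣ x n ∣ ℚ.≤ B)
  eventuallyBounded {x} cx =
    case cx 1ℚ (ℚₚ.positive⁻¹ 1ℚ) of λ (N , p) →
    N , 1ℚ ℚ.+ ℚ.∣ x N ∣
    , ℚₚ.pos+nonNeg⇒pos 1ℚ ℚ.∣ x N ∣ {{ℚₚ.∣-∣-nonNeg (x N)}}
    , λ n N≤n → begin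
      ℚ.∣ x n ∣
        ≡⟨ cong ℚ.∣_∣ (solve 2 (λ a b → a := (a :- b) :+ b) refl (x n) (x N)) ⟩
      ℚ.∣ (x n ℚ.- x N) ℚ.+ x N ∣
        ≤⟨ ℚₚ.∣p+q∣≤∣p∣+∣q∣ (x n ℚ.- x N) (x N) ⟩
      ℚ.∣ x n ℚ.- x N ∣ ℚ.+ ℚ.∣ x N ∣
        ≤⟨ ℚₚ.+-monoˡ-≤ ℚ.∣ x N ∣ (p n N N≤n ℕₚ.≤-refl) ⟩
      1ℚ ℚ.+ ℚ.∣ x N ∣ ∎
    where
    open ℚₚ.≤-Reasoning
    open +-*-Solver

  *-mono-≤-abs : ∀ p q {r s} → ℚ.∣ p ∣ ℚ.≤ r → ℚ.∣ q ∣ ℚ.≤ s → ℚ.∣ p ℚ.* q ∣ ℚ.≤ r ℚ.* s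
  *-mono-≤-abs p q {r} {s} ∣p∣≤r ∣q∣≤s = begin
    ℚ.∣ p ℚ.* q ∣          ≡⟨ ℚₚ.∣p*q∣≡∣p∣*∣q∣ p q ⟩
    ℚ.∣ p ∣ ℚ.* ℚ.∣ q ∣    ≤⟨ ℚₚ.*-monoʳ-≤-nonNeg ℚ.∣ q ∣ {{ℚₚ.∣-∣-nonNeg q}} ∣p∣≤r ⟩
    r ℚ.* ℚ.∣ q ∣          ≤⟨ ℚₚ.*-monoˡ-≤-nonNeg r {{ℚ.nonNegative 0≤r}} ∣q∣≤s ⟩
    r ℚ.* s                ∎
    where
    open ℚₚ.≤-Reasoning
    0≤r : 0ℚ ℚ.≤ r
    0≤r = ℚₚ.≤-trans (ℚₚ.0≤∣p∣ p) ∣p∣≤r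

  scale : ∀ B C ε → ℚ.Positive B → ℚ.Positive C → 0ℚ ℚ.< ε →
          ∃ λ δ → 0ℚ ℚ.< δ × B ℚ.* δ ℚ.+ δ ℚ.* C ≡ ε
  scale B C ε B>0 C>0 0<ε = δ , ℚₚ.positive⁻¹ δ {{δ>0}} , eq
    where
    open ℚₚ.≤-Reasoning
    open +-*-Solver
    K>0 : ℚ.Positive (B ℚ.+ C)
    K>0 = ℚₚ.pos+pos⇒pos B {{B>0}} C {{C>0}}
    K≢0 : ℚ.NonZero (B ℚ.+ C)
    K≢0 = ℚₚ.pos⇒nonZero (B ℚ.+ C) {{K>0}}
    K⁻¹ δ : ℚ
    K⁻¹ = (ℚ.1/ (B ℚ.+ C)) {{K≢0}}
    δ = ε ℚ.* K⁻¹
    δ>0 : ℚ.Positive δ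
    δ>0 = ℚₚ.pos*pos⇒pos ε {{ℚ.positive 0<ε}} K⁻¹ {{ℚₚ.1/pos⇒pos (B ℚ.+ C) {{K>0}}}}
    eq : B ℚ.* δ ℚ.+ δ ℚ.* C ≡ ε
    eq = begin-equality
      B ℚ.* (ε ℚ.* K⁻¹) ℚ.+ (ε ℚ.* K⁻¹) ℚ.* C
        ≡⟨ solve 4 (λ b c e k → b :* (e :* k) :+ (e :* k) :* c := e :* ((b :+ c) :* k))
                 refl B C ε K⁻¹ ⟩
      ε ℚ.* ((B ℚ.+ C) ℚ.* K⁻¹)
        ≡⟨ cong (ε ℚ.*_) (ℚₚ.*-inverseʳ (B ℚ.+ C) {{K≢0}}) ⟩
      ε ℚ.* 1ℚ
        ≡⟨ ℚₚ.*-identityʳ ε ⟩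
      ε ∎

  *-cauchy : ∀ {x y} → IsCauchy x → IsCauchy y → IsCauchy (λ n → x n ℚ.* y n)
  *-cauchy {x} {y} cx cy ε 0<ε =
    case eventuallyBounded {x} cx of λ (M , B , B>0 , x≤B) →
    case eventuallyBounded {y} cy of λ (N , C , C>0 , y≤C) →
    case scale B C ε B>0 C>0 0<ε of λ (δ , 0<δ , Bδ+δC≡ε) →
    case cx δ 0<δ of λ (M′ , p) →
    case cy δ 0<δ of λ (N′ , q) →
    (M ℕ.⊔ N) ℕ.⊔ (M′ ℕ.⊔ N′) , λ m n K≤m K≤n →
      let K₁≤m = ℕₚ.m⊔n≤o⇒m≤o (M ℕ.⊔ N) (M′ ℕ.⊔ N′) K≤m
          K₂≤m = ℕₚ.m⊔n≤o⇒n≤o (M ℕ.⊔ N) (M′ ℕ.⊔ N′) K≤m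
          K₁≤n = ℕₚ.m⊔n≤o⇒m≤o (M ℕ.⊔ N) (M′ ℕ.⊔ N′) K≤n
          K₂≤n = ℕₚ.m⊔n≤o⇒n≤o (M ℕ.⊔ N) (M′ ℕ.⊔ N′) K≤n
          x-bound = x≤B m (ℕₚ.m⊔n≤o⇒m≤o M N K₁≤m)
          y-bound = y≤C n (ℕₚ.m⊔n≤o⇒n≤o M N K₁≤n)
          x-close = p m n (ℕₚ.m⊔n≤o⇒m≤o M′ N′ K₂≤m) (ℕₚ.m⊔n≤o⇒m≤o M′ N′ K₂≤n)
          y-close = q m n (ℕₚ.m⊔n≤o⇒n≤o M′ N′ K₂≤m) (ℕₚ.m⊔n≤o⇒n≤o M′ N′ K₂≤n)
      in begin
      ℚ.∣ x m ℚ.* y m ℚ.- x n ℚ.* y n ∣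
        ≡⟨ cong ℚ.∣_∣ (rearrange (x m) (y m) (x n) (y n)) ⟩
      ℚ.∣ x m ℚ.* (y m ℚ.- y n) ℚ.+ (x m ℚ.- x n) ℚ.* y n ∣
        ≤⟨ ℚₚ.∣p+q∣≤∣p∣+∣q∣ (x m ℚ.* (y m ℚ.- y n)) ((x m ℚ.- x n) ℚ.* y n) ⟩
      ℚ.∣ x m ℚ.* (y m ℚ.- y n) ∣ ℚ.+ ℚ.∣ (x m ℚ.- x n) ℚ.* y n ∣
        ≤⟨ ℚₚ.+-mono-≤ (*-mono-≤-abs (x m) (y m ℚ.- y n) x-bound y-close)
                       (*-mono-≤-abs (x m ℚ.- x n) (y n) x-close y-bound) ⟩
      B ℚ.* δ ℚ.+ δ ℚ.* C
        ≡⟨ Bδ+δC≡ε ⟩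
      ε ∎
    where
    open ℚₚ.≤-Reasoning
    open +-*-Solver
    rearrange : ∀ a b c d →
      a ℚ.* b ℚ.- c ℚ.* d ≡ a ℚ.* (b ℚ.- d) ℚ.+ (a ℚ.- c) ℚ.* d
    rearrange = solve 4 (λ a b c d → a :* b :- c :* d := a :* (b :- d) :+ (a :- c) :* d) refl

_+_ : ℝ → ℝ → ℝ
x + y = mkℝ (λ n → seq x n ℚ.+ seq y n) (+-cauchy {seq x} {seq y} (cauchy x) (cauchy y))

_*_ : ℝ → ℝ → ℝ
x * y = mkℝ (λ n → seq x n ℚ.* seq y n) (*-cauchy {seq x} {seq y} (cauchy x) (cauchy y))

ℝ-+-rawMonoid : RawMonoid 0ℓ 0ℓ
ℝ-+-rawMonoid = record { Carrier = ℝ ; _≈_ = _≈_ ; _∙_ = _+_ ; ε = 0ℝ }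

∑ : ∀ {k} → Vector ℝ k → ℝ
∑ = RawMonoidDefs.sum ℝ-+-rawMonoid

-- Lattice points are first-order vectors, so that _≡_ is their intended
-- equality; points of ℝ^ n are only compared coordinatewise by _≈_.

ℤ^ ℝ^ : ℕ → Set
ℤ^ n = Vec ℤ n
ℝ^ n = Vector ℝ n

infixl 6 _⊕_

_⊕_ : ∀ {n} → ℤ^ n → ℤ^ n → ℤ^ n
_⊕_ = zipWith ℤ._+_

ι : ∀ {n} → ℤ^ n → ℝ^ n
ι z c = fromℤ (lookup z c)

record IsConvexCombination {n k} (p : Vector (ℝ^ n) k) (x : ℝ^ n) (w : Vector ℝ k) : Set where
  field
    nonNegative : ∀ i → 0ℝ ≤ w i
    sumsToOne   : ∑ w ≈ 1ℝ
    combination : ∀ c → x c ≈ ∑ (λ i → w i * p i c)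

convexHull : ∀ {n k} → Vector (ℝ^ n) k → Pred (ℝ^ n) 0ℓ
convexHull p x = ∃ (IsConvexCombination p x)

IsLatticePolytope : ∀ {n} → Pred (ℝ^ n) 0ℓ → Set
IsLatticePolytope {n} P = ∃₂ λ k (p : Vector (ℤ^ n) k) → P ≐ convexHull (map ι p)

𝓛 : ∀ {n} → Pred (ℝ^ n) 0ℓ → Pred (ℤ^ n) 0ℓ
𝓛 P z = ι z ∈ P

-- v lists each element of S exactly once; in particular |S| = N.

record Enumerates {n N} (v : Vector (ℤ^ n) N) (S : Pred (ℤ^ n) 0ℓ) : Set where
  field
    injective : Injective _≡_ _≡_ v
    complete  : ∀ z → z ∈ S ⇔ (∃ λ i → v i ≡ z)

-- The conclusion is the equality {i , j} = {k , l} of multisets.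

DistinctPairSums : ∀ {n N} → Vector (ℤ^ n) N → Set
DistinctPairSums v = ∀ i j k l → v i ⊕ v j ≡ v k ⊕ v l →
  (i ≡ k × j ≡ l) ⊎ (i ≡ l × j ≡ k)

record IsDPSPolytope {n} (P : Pred (ℝ^ n) 0ℓ) : Set where
  field
    isLatticePolytope : IsLatticePolytope P
    N                 : ℕ
    v                 : Vector (ℤ^ n) N
    enumerates        : Enumerates v (𝓛 P)
    distinctPairSums  : DistinctPairSums v

IsMaximal : ∀ {n} {P : Pred (ℝ^ n) 0ℓ} → IsDPSPolytope P → Set
IsMaximal {n} dps = IsDPSPolytope.N dps ≡ 2 ℕ.^ n

{-# OPTIONS --safe #-}

-- If p + A q determines p and q for p, q in a dps polytope P, where A ∈ GLₙ(ℤ), then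
-- placing P at height 0 and A P at height 1 gives a dps polytope in dimension n + 1 with
-- twice as many lattice points: a sum of two points has height 0, 1 or 2, and no lattice
-- point of the hull lies strictly between the two layers. Such an A is the product of
-- two shears whose entries are powers of a large K, since p + A q then has the coordinates
-- of q as digits in base K. For n = 1 the only A are ±1, which fail, so the induction
-- starts from 0 and from a triangle in dimension 2.
-- That the hull contains no further lattice points is carried through the induction by
-- integer certificates: each lattice point other than the given ones is strictly separated
-- from them by an additive functional.

module Submission where

open import Defs
open import Algebra.Bundles using (AbelianGroup; CommutativeRing)
open import Algebra.Properties.Group using (∙-cancelʳ)
open import Data.Empty using (⊥-elim)
open import Data.Fin using (Fin; zero; suc; _↑ˡ_; _↑ʳ_; splitAt; join)
import Data.Fin.Properties as Finₚ
open import Data.Integer as ℤ using (ℤ; +_; -[1+_]; 0ℤ; 1ℤ; ∣_∣; +<+; -<+)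
import Data.Integer.Properties as ℤₚ
import Data.Integer.Solver as ℤSolver
open import Data.Nat as ℕ using (ℕ; zero; suc; _≥_)
import Data.Nat.Properties as ℕₚ
open import Data.Product using (Σ-syntax; ∃; _×_; _,_; proj₁; proj₂)
open import Data.Rational as ℚ using (ℚ; 0ℚ; 1ℚ; ½)
import Data.Rational.Properties as ℚₚ
import Data.Rational.Solver as ℚSolver
open import Data.Rational.Unnormalised as ℚᵘ using (mkℚᵘ)
import Data.Rational.Unnormalised.Properties as ℚᵘₚ
open import Data.Sum using (_⊎_; inj₁; inj₂; [_,_])
open import Data.Vec using ([]; _∷_; head; tail; lookup; replicate)
open import Data.Vec.Functional using (Vector; map; _++_)
open import Data.Vec.Functional.Properties using (lookup-++ˡ; lookup-++ʳ)
open import Data.Vec.Properties using (∷-injective; ≡-dec)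
open import Data.Vec.Relation.Unary.All as All using (All; []; _∷_)
open import Function using (id; _∘_; mk⇔)
open import Level using (0ℓ)
open import Relation.Binary.PropositionalEquality
  using (_≡_; refl; sym; trans; cong; cong₂; subst; subst₂; module ≡-Reasoning)
open import Relation.Nullary using (¬_)
open import Relation.Nullary.Decidable
  using (True; toWitness; toWitnessFalse; _→-dec_; _×-dec_; _⊎-dec_)
open import Relation.Unary using (Pred; _∈_)
open import Algebra.Properties.Semiring.Sum (CommutativeRing.semiring ℚₚ.+-*-commutativeRing)
  using (sum; sum-cong-≗; ∑-distrib-+; *-distribˡ-sum; *-distribʳ-sum)

private variable
  n N k : ℕ

-- Separation certificates and lattice arithmetic

Additive : (ℤ^ n → ℤ) → Set
Additive f = ∀ x y → f (x ⊕ y) ≡ f x ℤ.+ f y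

-- The functional is an arbitrary additive map, not a coefficient vector, so that it can be
-- precomposed with `A⁻¹` directly. Strictness between integers is a gap of at least 1, which
-- survives the passage to limits of real weights.
Separates : (ℤ^ n → ℤ) → Vector (ℤ^ n) N → ℤ^ n → Set
Separates f v z = Additive f × (∀ i → f (v i) ℤ.< f z)

-- A disjunction with data: it decides which lattice points lie in the hull without computing with
-- reals.
Separated : Vector (ℤ^ n) N → Set
Separated v = ∀ z → (∃ λ i → v i ≡ z) ⊎ (∃ λ f → Separates f v z)

-- Compare the doubled sums `v i ⊕ v i` and `v j ⊕ v j`.
dps⇒injective : {v : Vector (ℤ^ n) N} → DistinctPairSums v → ∀ {i j} → v i ≡ v j → i ≡ j
dps⇒injective dps {i} {j} eq = [ proj₁ , proj₁ ] (dps i i j j (cong₂ _⊕_ eq eq))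

⊕-comm : (x y : ℤ^ n) → x ⊕ y ≡ y ⊕ x
⊕-comm []       []       = refl
⊕-comm (x ∷ xs) (y ∷ ys) = cong₂ _∷_ (ℤₚ.+-comm x y) (⊕-comm xs ys)

+-cancelʳ : ∀ z x y → x ℤ.+ z ≡ y ℤ.+ z → x ≡ y
+-cancelʳ = ∙-cancelʳ (AbelianGroup.group ℤₚ.+-0-abelianGroup)

⊕-cancelʳ : (z x y : ℤ^ n) → x ⊕ z ≡ y ⊕ z → x ≡ y
⊕-cancelʳ []       []       []       _  = refl
⊕-cancelʳ (z ∷ zs) (x ∷ xs) (y ∷ ys) eq =
  let eq₀ , eqs = ∷-injective eq in
  cong₂ _∷_ (+-cancelʳ z x y eq₀) (⊕-cancelʳ zs xs ys eqs)

-- Bounds for finite families of integers and of vectors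

boundedAbove : (g : Fin N → ℤ) → ∃ λ b → ∀ i → g i ℤ.≤ b
boundedAbove {zero}  g = 0ℤ , λ ()
boundedAbove {suc N} g with b , g≤b ← boundedAbove (g ∘ suc) =
  g zero ℤ.⊔ b , λ where
    zero    → ℤₚ.i≤i⊔j (g zero) b
    (suc i) → ℤₚ.≤-trans (g≤b i) (ℤₚ.i≤j⊔i (g zero) b)

Bounded : ℕ → ℤ^ n → Set
Bounded B = All (λ x → ∣ x ∣ ℕ.≤ B)

bounded-mono : ∀ {B C} → B ℕ.≤ C → {x : ℤ^ n} → Bounded B x → Bounded C x
bounded-mono B≤C = All.map (λ x≤B → ℕₚ.≤-trans x≤B B≤C)

bounded : (x : ℤ^ n) → ∃ λ B → Bounded B x
bounded []       = 0 , []
bounded (x ∷ xs) with B , xs≤B ← bounded xs =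
  ∣ x ∣ ℕ.⊔ B , ℕₚ.m≤m⊔n ∣ x ∣ B ∷ bounded-mono (ℕₚ.m≤n⊔m ∣ x ∣ B) xs≤B

allBounded : (v : Vector (ℤ^ n) N) → ∃ λ B → ∀ i → Bounded B (v i)
allBounded {N = zero}  v = 0 , λ ()
allBounded {N = suc N} v with bounded (v zero) | allBounded (v ∘ suc)
... | B , v₀≤B | C , v≤C = B ℕ.⊔ C , λ where
  zero    → bounded-mono (ℕₚ.m≤m⊔n B C) v₀≤B
  (suc i) → bounded-mono (ℕₚ.m≤n⊔m B C) (v≤C i)

-- Stacking a configuration and its image under `A`

module Stacking
  (v : Vector (ℤ^ n) N) (A A⁻¹ : ℤ^ n → ℤ^ n)
  (A∘A⁻¹ : ∀ x → A (A⁻¹ x) ≡ x) (A⁻¹∘A : ∀ x → A⁻¹ (A x) ≡ x)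
  (A⁻¹-additive : ∀ x y → A⁻¹ (x ⊕ y) ≡ A⁻¹ x ⊕ A⁻¹ y)
  where

  bottom top : Vector (ℤ^ (suc n)) N
  bottom = map (0ℤ ∷_) v
  top    = map (1ℤ ∷_) (map A v)

  stack : Vector (ℤ^ (suc n)) (N ℕ.+ N)
  stack = bottom ++ top

  separate : ∀ {z} f → Additive f →
    (∀ i → f (bottom i) ℤ.< f z) → (∀ i → f (top i) ℤ.< f z) → ∃ λ f → Separates f stack z
  separate {z} f f+ bottom< top< = f , f+ , stack<
    where
    stack< : ∀ i → f (stack i) ℤ.< f z
    stack< i with splitAt N i
    ... | inj₁ j = bottom< j
    ... | inj₂ j = top< j

  -- Adding a multiple of the height keeps all comparisons within a layer and shifts the layers
  -- against each other.
  tilt : (ℤ^ n → ℤ) → ℤ → ℤ^ (suc n) → ℤ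
  tilt f c (x ∷ xs) = f xs ℤ.+ c ℤ.* x

  tilt-additive : ∀ {f} c → Additive f → Additive (tilt f c)
  tilt-additive {f} c f+ (x ∷ xs) (y ∷ ys) rewrite f+ xs ys =
    solve 5 (λ a b c x y → a :+ b :+ c :* (x :+ y) := a :+ c :* x :+ (b :+ c :* y)) refl
      (f xs) (f ys) c x y
    where open ℤSolver.+-*-Solver

  tilt₀ : ∀ f c x → tilt f c (0ℤ ∷ x) ≡ f x
  tilt₀ f c x = solve 2 (λ a c → a :+ c :* con 0ℤ := a) refl (f x) c
    where open ℤSolver.+-*-Solver

  tilt₁ : ∀ f c x → tilt f c (1ℤ ∷ x) ≡ f x ℤ.+ c
  tilt₁ f c x = solve 2 (λ a c → a :+ c :* con 1ℤ := a :+ c) refl (f x) c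
    where open ℤSolver.+-*-Solver

  -- Heights below 0 and above 1 are separated by minus and plus the height. Within a layer, the
  -- certificate for `x`, or the one for `A⁻¹ x` pulled back along `A⁻¹`, is tilted until the whole
  -- opposite layer falls below the point.
  stack-separated : Separated v → Separated stack
  stack-separated sep (-[1+ h ] ∷ x) = inj₂ (separate (ℤ.-_ ∘ head)
    (λ { (x ∷ _) (y ∷ _) → ℤₚ.neg-distrib-+ x y }) (λ _ → +<+ ℕ.z<s) (λ _ → -<+))
  stack-separated sep (+ 0 ∷ x) with sep x
  ... | inj₁ (i , eq) = inj₁ (i ↑ˡ N , trans (lookup-++ˡ bottom top i) (cong (0ℤ ∷_) eq))
  ... | inj₂ (f , f+ , f<) with b , fA≤b ← boundedAbove (f ∘ A ∘ v) =
    inj₂ (separate (tilt f c) (tilt-additive c f+)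
      (λ i → subst₂ ℤ._<_ (sym (tilt₀ f c (v i))) (sym (tilt₀ f c x)) (f< i))
      (λ i → subst₂ ℤ._<_ (sym (tilt₁ f c (A (v i)))) (sym (tilt₀ f c x)) (below i)))
    where
    -- As `b` bounds `f` on the top layer, this tilt lowers that layer to at most `f x` minus 1.
    c = f x ℤ.- b ℤ.- 1ℤ
    open ℤₚ.≤-Reasoning
    below : ∀ i → f (A (v i)) ℤ.+ c ℤ.< f x
    below i = begin-strict
      f (A (v i)) ℤ.+ c  ≤⟨ ℤₚ.+-monoˡ-≤ c (fA≤b i) ⟩
      b ℤ.+ c            ≡⟨ solve 2 (λ b a → b :+ (a :- b :- con 1ℤ) := con (-[1+ 0 ]) :+ a) refl b (f x) ⟩
      ℤ.pred (f x)       <⟨ ℤₚ.i≤pred[j]⇒i<j ℤₚ.≤-refl ⟩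
      f x                ∎
      where open ℤSolver.+-*-Solver
  stack-separated sep (+ 1 ∷ x) with sep (A⁻¹ x)
  ... | inj₁ (i , eq) = inj₁ (N ↑ʳ i , trans (lookup-++ʳ bottom top i)
                          (cong (1ℤ ∷_) (trans (cong A eq) (A∘A⁻¹ x))))
  ... | inj₂ (f , f+ , f<) with b , fA⁻¹≤b ← boundedAbove (f ∘ A⁻¹ ∘ v) =
    inj₂ (separate (tilt g c)
      (tilt-additive c (λ x y → trans (cong f (A⁻¹-additive x y)) (f+ (A⁻¹ x) (A⁻¹ y))))
      (λ i → subst₂ ℤ._<_ (sym (tilt₀ g c (v i))) (sym (tilt₁ g c x)) (above i))
      (λ i → subst₂ ℤ._<_ (sym (tilt₁ g c (A (v i)))) (sym (tilt₁ g c x))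
        (ℤₚ.+-monoˡ-< c (subst (λ y → f y ℤ.< f (A⁻¹ x)) (sym (A⁻¹∘A (v i))) (f< i)))))
    where
    g = f ∘ A⁻¹
    -- The point is moved to the value b + 1, while the bottom layer keeps values at most `b`.
    c = ℤ.suc b ℤ.- g x
    open ℤₚ.≤-Reasoning
    above : ∀ i → g (v i) ℤ.< g x ℤ.+ c
    above i = begin-strict
      g (v i)   ≤⟨ fA⁻¹≤b i ⟩
      b         <⟨ ℤₚ.suc[i]≤j⇒i<j ℤₚ.≤-refl ⟩
      ℤ.suc b   ≡⟨ solve 2 (λ s a → s := a :+ (s :- a)) refl (ℤ.suc b) (g x) ⟩
      g x ℤ.+ c ∎
      where open ℤSolver.+-*-Solver
  stack-separated sep (+ suc (suc h) ∷ x) = inj₂ (separate head (λ { (_ ∷ _) (_ ∷ _) → refl })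
    (λ _ → +<+ ℕ.z<s) (λ _ → +<+ (ℕ.s<s ℕ.z<s)))

  stack-dps : DistinctPairSums v →
    (∀ i j k l → v i ⊕ A (v j) ≡ v k ⊕ A (v l) → v i ≡ v k × v j ≡ v l) →
    DistinctPairSums stack
  stack-dps dps apart i j k l eq =
    [ (λ (p , q) → inj₁ (inj p , inj q)) , (λ (p , q) → inj₂ (inj p , inj q)) ]
      (main (splitAt N i) (splitAt N j) (splitAt N k) (splitAt N l) eq)
    where
    inj : ∀ {i j} → splitAt N i ≡ splitAt N j → i ≡ j
    inj {i} {j} eq = trans (sym (Finₚ.join-splitAt N N i))
      (trans (cong (join N N) eq) (Finₚ.join-splitAt N N j))

    -- `stack i` unfolds to `point (splitAt N i)`, so `main` can match on layers and still accept
    -- `eq`.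
    point : Fin N ⊎ Fin N → ℤ^ (suc n)
    point = [ bottom , top ]

    tails : ∀ {a b} {x y : ℤ^ n} → a ∷ x ≡ b ∷ y → x ≡ y
    tails = proj₂ ∘ ∷-injective

    apart′ : ∀ i j k l → v i ⊕ A (v j) ≡ v k ⊕ A (v l) → i ≡ k × j ≡ l
    apart′ i j k l eq with p , q ← apart i j k l eq = dps⇒injective dps p , dps⇒injective dps q

    top-dps : ∀ i j k l → A (v i) ⊕ A (v j) ≡ A (v k) ⊕ A (v l) → v i ⊕ v j ≡ v k ⊕ v l
    top-dps i j k l eq = begin
      v i ⊕ v j                     ≡⟨ cong₂ _⊕_ (A⁻¹∘A (v i)) (A⁻¹∘A (v j)) ⟨
      A⁻¹ (A (v i)) ⊕ A⁻¹ (A (v j)) ≡⟨ A⁻¹-additive _ _ ⟨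
      A⁻¹ (A (v i) ⊕ A (v j))       ≡⟨ cong A⁻¹ eq ⟩
      A⁻¹ (A (v k) ⊕ A (v l))       ≡⟨ A⁻¹-additive _ _ ⟩
      A⁻¹ (A (v k)) ⊕ A⁻¹ (A (v l)) ≡⟨ cong₂ _⊕_ (A⁻¹∘A (v k)) (A⁻¹∘A (v l)) ⟩
      v k ⊕ v l                     ∎
      where open ≡-Reasoning

    main : ∀ s t u w → point s ⊕ point t ≡ point u ⊕ point w → (s ≡ u × t ≡ w) ⊎ (s ≡ w × t ≡ u)
    main (inj₁ i) (inj₁ j) (inj₁ k) (inj₁ l) eq with dps i j k l (tails eq)
    ... | inj₁ (p , q) = inj₁ (cong inj₁ p , cong inj₁ q)
    ... | inj₂ (p , q) = inj₂ (cong inj₁ p , cong inj₁ q)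
    main (inj₂ i) (inj₂ j) (inj₂ k) (inj₂ l) eq with dps i j k l (top-dps i j k l (tails eq))
    ... | inj₁ (p , q) = inj₁ (cong inj₂ p , cong inj₂ q)
    ... | inj₂ (p , q) = inj₂ (cong inj₂ p , cong inj₂ q)
    main (inj₁ i) (inj₂ j) (inj₁ k) (inj₂ l) eq with p , q ← apart′ i j k l (tails eq) =
      inj₁ (cong inj₁ p , cong inj₂ q)
    -- Mixed sums in the other order are swapped so that the bottom point comes first, as `apart′`
    -- requires.
    main (inj₁ i) (inj₂ j) (inj₂ k) (inj₁ l) eq
      with p , q ← apart′ i j l k (trans (tails eq) (⊕-comm _ _)) =
      inj₂ (cong inj₁ p , cong inj₂ q)
    main (inj₂ i) (inj₁ j) (inj₁ k) (inj₂ l) eq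
      with p , q ← apart′ j i k l (trans (⊕-comm _ _) (tails eq)) =
      inj₂ (cong inj₂ q , cong inj₁ p)
    main (inj₂ i) (inj₁ j) (inj₂ k) (inj₁ l) eq
      with p , q ← apart′ j i l k (trans (⊕-comm _ _) (trans (tails eq) (⊕-comm _ _))) =
      inj₁ (cong inj₂ q , cong inj₁ p)
    -- In the ten remaining cases the two sides contain different numbers of top points, so their
    -- heights differ.
    main (inj₁ _) (inj₁ _) (inj₁ _) (inj₂ _) eq with () ← cong head eq
    main (inj₁ _) (inj₁ _) (inj₂ _) (inj₁ _) eq with () ← cong head eq
    main (inj₁ _) (inj₁ _) (inj₂ _) (inj₂ _) eq with () ← cong head eq
    main (inj₁ _) (inj₂ _) (inj₁ _) (inj₁ _) eq with () ← cong head eq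
    main (inj₁ _) (inj₂ _) (inj₂ _) (inj₂ _) eq with () ← cong head eq
    main (inj₂ _) (inj₁ _) (inj₁ _) (inj₁ _) eq with () ← cong head eq
    main (inj₂ _) (inj₁ _) (inj₂ _) (inj₂ _) eq with () ← cong head eq
    main (inj₂ _) (inj₂ _) (inj₁ _) (inj₁ _) eq with () ← cong head eq
    main (inj₂ _) (inj₂ _) (inj₁ _) (inj₂ _) eq with () ← cong head eq
    main (inj₂ _) (inj₂ _) (inj₂ _) (inj₁ _) eq with () ← cong head eq

-- Digits in base `K`

horner : ℤ → ℤ^ n → ℤ
horner K []       = 0ℤ
horner K (x ∷ xs) = x ℤ.+ K ℤ.* horner K xs

horner-additive : ∀ K → Additive (horner {n} K)
horner-additive K []       []       = refl
horner-additive K (x ∷ xs) (y ∷ ys) rewrite horner-additive K xs ys =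
  solve 5 (λ K x y a b → x :+ y :+ K :* (a :+ b) := x :+ K :* a :+ (y :+ K :* b)) refl
    K x y (horner K xs) (horner K ys)
  where open ℤSolver.+-*-Solver

-- The number 2B + 1 of integers in [-B, B], which serve as balanced digits.
radix : ℕ → ℤ
radix B = + suc (B ℕ.+ B)

-- The difference b - a is the multiple K (h - h′) of K, and its absolute value is at most 2B, which
-- is less than K.
quotient-unique : ∀ B {a b h h′} → ∣ a ∣ ℕ.≤ B → ∣ b ∣ ℕ.≤ B →
  a ℤ.+ radix B ℤ.* h ≡ b ℤ.+ radix B ℤ.* h′ → h ≡ h′
quotient-unique B {a} {b} {h} {h′} a≤B b≤B eq = ℤₚ.i-j≡0⇒i≡j h h′ (ℤₚ.∣i∣≡0⇒i≡0 (vanish _ small))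
  where
  open ℤSolver.+-*-Solver
  K = radix B

  diff : K ℤ.* (h ℤ.- h′) ≡ b ℤ.- a
  diff = begin
    K ℤ.* (h ℤ.- h′)
      ≡⟨ solve 4 (λ K h h′ a → K :* (h :- h′) := a :+ K :* h :- (a :+ K :* h′)) refl K h h′ a ⟩
    a ℤ.+ K ℤ.* h ℤ.- (a ℤ.+ K ℤ.* h′)
      ≡⟨ cong (ℤ._- (a ℤ.+ K ℤ.* h′)) eq ⟩
    b ℤ.+ K ℤ.* h′ ℤ.- (a ℤ.+ K ℤ.* h′)
      ≡⟨ solve 4 (λ K h′ a b → b :+ K :* h′ :- (a :+ K :* h′) := b :- a) refl K h′ a b ⟩
    b ℤ.- a ∎
    where open ≡-Reasoning

  small : suc (B ℕ.+ B) ℕ.* ∣ h ℤ.- h′ ∣ ℕ.≤ B ℕ.+ B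
  small = begin
    suc (B ℕ.+ B) ℕ.* ∣ h ℤ.- h′ ∣ ≡⟨ ℤₚ.abs-* K (h ℤ.- h′) ⟨
    ∣ K ℤ.* (h ℤ.- h′) ∣           ≡⟨ cong ∣_∣ diff ⟩
    ∣ b ℤ.- a ∣                    ≤⟨ ℤₚ.∣i-j∣≤∣i∣+∣j∣ b a ⟩
    ∣ b ∣ ℕ.+ ∣ a ∣                ≤⟨ ℕₚ.+-mono-≤ b≤B a≤B ⟩
    B ℕ.+ B                        ∎
    where open ℕₚ.≤-Reasoning

  vanish : ∀ d → suc (B ℕ.+ B) ℕ.* d ℕ.≤ B ℕ.+ B → d ≡ 0
  vanish zero    _ = refl
  vanish (suc d) p = ⊥-elim (ℕₚ.<-irrefl refl (ℕₚ.≤-trans (ℕₚ.m≤m*n (suc (B ℕ.+ B)) (suc d)) p))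

digits-unique : ∀ B {a b h h′} → ∣ a ∣ ℕ.≤ B → ∣ b ∣ ℕ.≤ B →
  a ℤ.+ radix B ℤ.* h ≡ b ℤ.+ radix B ℤ.* h′ → a ≡ b × h ≡ h′
digits-unique B {a} {b} {h} a≤B b≤B eq with refl ← quotient-unique B {a} {b} {h} a≤B b≤B eq =
  +-cancelʳ (radix B ℤ.* h) a b eq , refl

horner-injective : ∀ B {x y : ℤ^ n} → Bounded B x → Bounded B y →
  horner (radix B) x ≡ horner (radix B) y → x ≡ y
horner-injective B [] [] eq = refl
horner-injective B (x≤B ∷ xs≤B) (y≤B ∷ ys≤B) eq =
  let x≡y , eqs = digits-unique B x≤B y≤B eq in
  cong₂ _∷_ x≡y (horner-injective B xs≤B ys≤B eqs)

-- A unimodular map built from two shears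

module Skew (K : ℤ) where

  -- The first shear adds K times the number with digits x₁, x₂, ... to x₀, the second adds K times
  -- the new first coordinate to x₁. After the first shear alone x₀ is only a lowest digit, where it
  -- mixes with another summand; the second makes it a higher digit as well. `unskew` undoes the
  -- shears in reverse order.
  skew unskew : ℤ^ (suc (suc n)) → ℤ^ (suc (suc n))
  skew (x₀ ∷ x₁ ∷ xs) = y₀ ∷ x₁ ℤ.+ K ℤ.* y₀ ∷ xs
    where y₀ = x₀ ℤ.+ K ℤ.* horner K (x₁ ∷ xs)
  unskew (y₀ ∷ y₁ ∷ ys) = y₀ ℤ.- K ℤ.* horner K (x₁ ∷ ys) ∷ x₁ ∷ ys
    where x₁ = y₁ ℤ.- K ℤ.* y₀

  open ℤSolver.+-*-Solver

  skew∘unskew : (x : ℤ^ (suc (suc n))) → skew (unskew x) ≡ x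
  skew∘unskew (y₀ ∷ y₁ ∷ ys) = cong₂ (λ a b → a ∷ b ∷ ys)
    (solve 2 (λ y a → y :- a :+ a := y) refl y₀ _)
    (solve 4 (λ K y z a → z :- K :* y :+ K :* (y :- a :+ a) := z) refl K y₀ y₁ _)

  unskew∘skew : (x : ℤ^ (suc (suc n))) → unskew (skew x) ≡ x
  unskew∘skew (x₀ ∷ x₁ ∷ xs) = cong₂ (λ a b → a ∷ b ∷ xs)
    (solve 4 (λ K x z h →
        let y = x :+ K :* (z :+ K :* h) in
        y :- K :* (z :+ K :* y :- K :* y :+ K :* h) := x) refl K x₀ x₁ (horner K xs))
    (solve 2 (λ z a → z :+ a :- a := z) refl x₁ _)

  unskew-additive : (x y : ℤ^ (suc (suc n))) → unskew (x ⊕ y) ≡ unskew x ⊕ unskew y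
  unskew-additive (x₀ ∷ x₁ ∷ xs) (y₀ ∷ y₁ ∷ ys) rewrite horner-additive K xs ys =
    cong₂ (λ a b → a ∷ b ∷ xs ⊕ ys)
      (solve 7 (λ K x z y w h k →
          x :+ y :- K :* (z :+ w :- K :* (x :+ y) :+ K :* (h :+ k))
          := x :- K :* (z :- K :* x :+ K :* h) :+ (y :- K :* (w :- K :* y :+ K :* k)))
        refl K x₀ x₁ y₀ y₁ (horner K xs) (horner K ys))
      (solve 5 (λ K x z y w → z :+ w :- K :* (x :+ y) := z :- K :* x :+ (w :- K :* y))
        refl K x₀ x₁ y₀ y₁)

-- The lowest digits are sums of two entries bounded by `B`, hence the radix for 2B. The higher
-- digits of the first two coordinates give all of `q`, and then `p` follows by cancellation.
skew-apart : ∀ B {p q p′ q′ : ℤ^ (suc (suc n))} → let open Skew (radix (B ℕ.+ B)) in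
  Bounded B p → Bounded B q → Bounded B p′ → Bounded B q′ →
  p ⊕ skew q ≡ p′ ⊕ skew q′ → p ≡ p′ × q ≡ q′
skew-apart B {p₀ ∷ p₁ ∷ p} {q₀ ∷ q₁ ∷ q} {r₀ ∷ r₁ ∷ r} {s₀ ∷ s₁ ∷ s}
  (p₀≤ ∷ p₁≤ ∷ _) (q₀≤ ∷ q₁≤ ∷ q≤) (r₀≤ ∷ r₁≤ ∷ _) (s₀≤ ∷ s₁≤ ∷ s≤) eq =
    ⊕-cancelʳ _ _ _ (trans eq (cong (λ z → (r₀ ∷ r₁ ∷ r) ⊕ skew z) (sym q≡s))) , q≡s
  where
  C = B ℕ.+ B
  K = radix C
  open Skew K
  h h′ : ℤ
  h = horner K (q₁ ∷ q)
  h′ = horner K (s₁ ∷ s)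

  add : ∀ {x y} → ∣ x ∣ ℕ.≤ B → ∣ y ∣ ℕ.≤ B → ∣ x ℤ.+ y ∣ ℕ.≤ C
  add {x} {y} x≤ y≤ = ℕₚ.≤-trans (ℤₚ.∣i+j∣≤∣i∣+∣j∣ x y) (ℕₚ.+-mono-≤ x≤ y≤)

  B≤C = ℕₚ.m≤m+n B B

  -- The first two coordinates of the sum are two-digit numbers in base K, with
  -- leading digits h and q₀ + K h respectively.
  eq₀ : (p₀ ℤ.+ q₀) ℤ.+ K ℤ.* h ≡ (r₀ ℤ.+ s₀) ℤ.+ K ℤ.* h′
  eq₀ = trans (ℤₚ.+-assoc p₀ q₀ _) (trans (cong head eq) (sym (ℤₚ.+-assoc r₀ s₀ _)))

  h≡h′ : h ≡ h′
  h≡h′ = quotient-unique C {p₀ ℤ.+ q₀} {r₀ ℤ.+ s₀} (add {p₀} p₀≤ q₀≤) (add {r₀} r₀≤ s₀≤) eq₀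

  eq₁ : (p₁ ℤ.+ q₁) ℤ.+ K ℤ.* (q₀ ℤ.+ K ℤ.* h) ≡ (r₁ ℤ.+ s₁) ℤ.+ K ℤ.* (s₀ ℤ.+ K ℤ.* h′)
  eq₁ = trans (ℤₚ.+-assoc p₁ q₁ _)
          (trans (cong (λ z → lookup z (suc zero)) eq) (sym (ℤₚ.+-assoc r₁ s₁ _)))

  q₀+Kh≡s₀+Kh′ : q₀ ℤ.+ K ℤ.* h ≡ s₀ ℤ.+ K ℤ.* h′
  q₀+Kh≡s₀+Kh′ = quotient-unique C {p₁ ℤ.+ q₁} {r₁ ℤ.+ s₁} (add {p₁} p₁≤ q₁≤) (add {r₁} r₁≤ s₁≤) eq₁

  q₀≡s₀ : q₀ ≡ s₀
  q₀≡s₀ = proj₁ (digits-unique C {h = h} {h′ = h′} (ℕₚ.≤-trans q₀≤ B≤C) (ℕₚ.≤-trans s₀≤ B≤C) q₀+Kh≡s₀+Kh′)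

  q≡s : q₀ ∷ q₁ ∷ q ≡ s₀ ∷ s₁ ∷ s
  q≡s = cong₂ _∷_ q₀≡s₀ (horner-injective C
    (bounded-mono B≤C (q₁≤ ∷ q≤)) (bounded-mono B≤C (s₁≤ ∷ s≤)) h≡h′)

-- The base case in dimension 2: a triangle with its centroid

triangle : Vector (ℤ^ 2) 4
triangle zero                   = + 0 ∷ + 0 ∷ []
triangle (suc zero)             = + 1 ∷ + 0 ∷ []
triangle (suc (suc zero))       = + 0 ∷ + 1 ∷ []
triangle (suc (suc (suc zero))) = -[1+ 0 ] ∷ -[1+ 0 ] ∷ []

triangle-dps : DistinctPairSums triangle
triangle-dps = toWitness {a? =
  Finₚ.all? λ i → Finₚ.all? λ j → Finₚ.all? λ k → Finₚ.all? λ l →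
    ≡-dec ℤ._≟_ (triangle i ⊕ triangle j) (triangle k ⊕ triangle l) →-dec
    ((i Finₚ.≟ k ×-dec j Finₚ.≟ l) ⊎-dec (i Finₚ.≟ l ×-dec j Finₚ.≟ k))} _

⟨_,_⟩ : ℤ → ℤ → ℤ^ 2 → ℤ
⟨ a , b ⟩ (x ∷ y ∷ []) = a ℤ.* x ℤ.+ b ℤ.* y

⟨,⟩-additive : ∀ a b → Additive ⟨ a , b ⟩
⟨,⟩-additive a b (x ∷ y ∷ []) (z ∷ w ∷ []) =
  solve 6 (λ a b x y z w → a :* (x :+ z) :+ b :* (y :+ w) := a :* x :+ b :* y :+ (a :* z :+ b :* w))
    refl a b x y z w
  where open ℤSolver.+-*-Solver

-- Every functional used is at most 1 on the triangle, which is a finite decidable check, so a value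
-- of at least 2 at `z` suffices. The edges lie on x + y = 1, x - 2y = 1 and y - 2x = 1; plus and
-- minus the coordinates serve for points farther out.
triangle-separates : ∀ a b z → {True (Finₚ.all? λ i → ⟨ a , b ⟩ (triangle i) ℤ.≤? 1ℤ)} →
  1ℤ ℤ.< ⟨ a , b ⟩ z → ∃ λ f → Separates f triangle z
triangle-separates a b z {≤1} 1<z =
  ⟨ a , b ⟩ , ⟨,⟩-additive a b , λ i → ℤₚ.≤-<-trans (toWitness ≤1 i) 1<z

1<2+ : ∀ {m} → 1ℤ ℤ.< + suc (suc m)
1<2+ = +<+ (ℕ.s<s ℕ.z<s)

triangle-separated : Separated triangle
triangle-separated (+ 1 ∷ + 0 ∷ [])                 = inj₁ (suc zero , refl)
triangle-separated (+ 0 ∷ + 0 ∷ [])                 = inj₁ (zero , refl)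
triangle-separated (+ 0 ∷ + 1 ∷ [])                 = inj₁ (suc (suc zero) , refl)
triangle-separated (-[1+ 0 ] ∷ -[1+ 0 ] ∷ [])       = inj₁ (suc (suc (suc zero)) , refl)
triangle-separated z@(+ 1 ∷ + suc _ ∷ [])           = inj₂ (triangle-separates 1ℤ 1ℤ z 1<2+)
triangle-separated z@(+ 1 ∷ -[1+ _ ] ∷ [])          = inj₂ (triangle-separates 1ℤ (-[1+ 1 ]) z 1<2+)
triangle-separated z@(+ 0 ∷ + suc (suc _) ∷ [])     = inj₂ (triangle-separates 0ℤ 1ℤ z 1<2+)
-- The value 2(y + 1) does not reduce to the shape `suc (suc _)`, so the bound needs a separate
-- argument.
triangle-separated z@(+ 0 ∷ -[1+ y ] ∷ [])          = inj₂ (triangle-separates 1ℤ (-[1+ 1 ]) z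
  (+<+ (ℕ.s<s (ℕₚ.≤-trans ℕ.z<s (ℕₚ.m≤n+m (suc (y ℕ.+ 0)) y)))))
triangle-separated z@(-[1+ 0 ] ∷ + 0 ∷ [])          = inj₂ (triangle-separates (-[1+ 1 ]) 1ℤ z 1<2+)
triangle-separated z@(-[1+ 0 ] ∷ + suc _ ∷ [])      = inj₂ (triangle-separates (-[1+ 1 ]) 1ℤ z 1<2+)
triangle-separated z@(-[1+ 0 ] ∷ -[1+ suc _ ] ∷ []) = inj₂ (triangle-separates 0ℤ (-[1+ 0 ]) z 1<2+)
triangle-separated z@(+ suc (suc x) ∷ y ∷ [])       = inj₂ (triangle-separates 1ℤ 0ℤ z
  (subst (1ℤ ℤ.<_) (solve 2 (λ x y → x := con 1ℤ :* x :+ con 0ℤ :* y) refl (+ suc (suc x)) y) 1<2+))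
  where open ℤSolver.+-*-Solver
triangle-separated z@(-[1+ suc x ] ∷ y ∷ [])        = inj₂ (triangle-separates (-[1+ 0 ]) 0ℤ z
  (subst (1ℤ ℤ.<_) (solve 2 (λ x y → :- x := con (-[1+ 0 ]) :* x :+ con 0ℤ :* y) refl -[1+ suc x ] y) 1<2+))
  where open ℤSolver.+-*-Solver

-- Induction on the dimension

record Configuration (n : ℕ) : Set where
  field
    size      : ℕ
    size≡2^n  : size ≡ 2 ℕ.^ n
    points    : Vector (ℤ^ n) size
    dps       : DistinctPairSums points
    separated : Separated points

skewStack : Configuration (suc (suc n)) → Configuration (suc (suc (suc n)))
skewStack c = record
  { size      = size ℕ.+ size
  ; size≡2^n  = cong₂ ℕ._+_ size≡2^n (trans size≡2^n (sym (ℕₚ.+-identityʳ _)))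
  ; points    = stack
  ; dps       = stack-dps dps λ i j k l →
                  skew-apart B (points≤B i) (points≤B j) (points≤B k) (points≤B l)
  ; separated = stack-separated separated
  }
  where
  open Configuration c
  B = proj₁ (allBounded points)
  points≤B = proj₂ (allBounded points)
  open Skew (radix (B ℕ.+ B))
  open Stacking points skew unskew skew∘unskew unskew∘skew unskew-additive

configuration : ∀ n → Configuration n
configuration 0 = record
  { size      = 1
  ; size≡2^n  = refl
  ; points    = λ _ → []
  ; dps       = λ { zero zero zero zero _ → inj₁ (refl , refl) }
  ; separated = λ { [] → inj₁ (zero , refl) }
  }
configuration 1 = record
  { size      = 2
  ; size≡2^n  = refl
  ; points    = stack
  -- Dimension 0 has a single point, so nothing has to be recovered from a mixed sum and `A` can be
  -- the identity.
  ; dps       = stack-dps dps λ { zero zero zero zero _ → refl , refl }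
  ; separated = stack-separated separated
  }
  where
  open Configuration (configuration 0)
  open Stacking points id id (λ _ → refl) (λ _ → refl) (λ _ _ → refl)
configuration 2 = record
  { size      = 4
  ; size≡2^n  = refl
  ; points    = triangle
  ; dps       = triangle-dps
  ; separated = triangle-separated
  }
configuration (suc n@(suc (suc _))) = skewStack (configuration n)

-- Convex hulls of separated configurations

toℚ : ℤ → ℚ
toℚ i = i ℚ./ 1

toℚᵘ-toℚ : ∀ i → ℚ.toℚᵘ (toℚ i) ℚᵘ.≃ mkℚᵘ i 0
toℚᵘ-toℚ i = ℚₚ.toℚᵘ-fromℚᵘ (mkℚᵘ i 0)

-- Passing to unnormalised rationals removes the gcd from addition and leaves a polynomial identity.
toℚ-+ : ∀ i j → toℚ (i ℤ.+ j) ≡ toℚ i ℚ.+ toℚ j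
toℚ-+ i j = ℚₚ.toℚᵘ-injective (begin
  ℚ.toℚᵘ (toℚ (i ℤ.+ j))                ≈⟨ toℚᵘ-toℚ (i ℤ.+ j) ⟩
  mkℚᵘ (i ℤ.+ j) 0                      ≈⟨ ℚᵘ.*≡* (solve 2 (λ i j →
    (i :+ j) :* con 1ℤ := (i :* con 1ℤ :+ j :* con 1ℤ) :* con 1ℤ) refl i j) ⟩
  mkℚᵘ i 0 ℚᵘ.+ mkℚᵘ j 0                ≈⟨ ℚᵘₚ.+-cong (toℚᵘ-toℚ i) (toℚᵘ-toℚ j) ⟨
  ℚ.toℚᵘ (toℚ i) ℚᵘ.+ ℚ.toℚᵘ (toℚ j)    ≈⟨ ℚₚ.toℚᵘ-homo-+ (toℚ i) (toℚ j) ⟨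
  ℚ.toℚᵘ (toℚ i ℚ.+ toℚ j)              ∎)
  where
  open import Relation.Binary.Reasoning.Setoid ℚᵘₚ.≃-setoid
  open ℤSolver.+-*-Solver

toℚ-* : ∀ i j → toℚ (i ℤ.* j) ≡ toℚ i ℚ.* toℚ j
toℚ-* i j = ℚₚ.toℚᵘ-injective (begin
  ℚ.toℚᵘ (toℚ (i ℤ.* j))                ≈⟨ toℚᵘ-toℚ (i ℤ.* j) ⟩
  mkℚᵘ i 0 ℚᵘ.* mkℚᵘ j 0                ≈⟨ ℚᵘₚ.*-cong (toℚᵘ-toℚ i) (toℚᵘ-toℚ j) ⟨
  ℚ.toℚᵘ (toℚ i) ℚᵘ.* ℚ.toℚᵘ (toℚ j)    ≈⟨ ℚₚ.toℚᵘ-homo-* (toℚ i) (toℚ j) ⟨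
  ℚ.toℚᵘ (toℚ i ℚ.* toℚ j)              ∎)
  where open import Relation.Binary.Reasoning.Setoid ℚᵘₚ.≃-setoid

-- Sequences with nonpositive upper limit and null sequences

-- lim sup s ≤ 0
Small : (ℕ → ℚ) → Set
Small s = ∀ ε → 0ℚ ℚ.< ε → ∃ λ M → ∀ t → M ℕ.≤ t → s t ℚ.≤ ε

Null : (ℕ → ℚ) → Set
Null s = Small (λ t → ℚ.∣ s t ∣)

small-≤ : ∀ {r s} → (∀ t → r t ℚ.≤ s t) → Small s → Small r
small-≤ r≤s s≤0 ε 0<ε with M , p ← s≤0 ε 0<ε = M , λ t M≤t → ℚₚ.≤-trans (r≤s t) (p t M≤t)

small-+ : ∀ {r s} → Small r → Small s → Small (λ t → r t ℚ.+ s t)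
small-+ r≤0 s≤0 ε 0<ε
  with δ , 0<δ , δ+δ≡ε ← halve ε 0<ε
  with M , p ← r≤0 δ 0<δ | L , q ← s≤0 δ 0<δ =
  M ℕ.⊔ L , λ t M⊔L≤t → subst (_ ℚ.≤_) δ+δ≡ε
    (ℚₚ.+-mono-≤ (p t (ℕₚ.m⊔n≤o⇒m≤o M L M⊔L≤t)) (q t (ℕₚ.m⊔n≤o⇒n≤o M L M⊔L≤t)))

small-* : ∀ c {s} → ℚ.NonNegative c → Small s → Small (λ t → c ℚ.* s t)
small-* c {s} c≥0 s≤0 ε 0<ε
  -- `c` may be zero while `scale` needs positive factors, so 1 + c takes its place; the surplus 2δ
  -- is given away.
  with δ , 0<δ , eq ← scale (1ℚ ℚ.+ c) 1ℚ ε (ℚₚ.pos+nonNeg⇒pos 1ℚ c {{c≥0}}) _ 0<ε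
  with M , p ← s≤0 δ 0<δ = M , λ t M≤t → begin
    c ℚ.* s t                     ≤⟨ ℚₚ.*-monoˡ-≤-nonNeg c {{c≥0}} (p t M≤t) ⟩
    c ℚ.* δ                       ≡⟨ ℚₚ.+-identityʳ _ ⟨
    c ℚ.* δ ℚ.+ 0ℚ                ≤⟨ ℚₚ.+-monoʳ-≤ (c ℚ.* δ) (ℚₚ.+-mono-≤ (ℚₚ.<⇒≤ 0<δ) (ℚₚ.<⇒≤ 0<δ)) ⟩
    c ℚ.* δ ℚ.+ (δ ℚ.+ δ)         ≡⟨ solve 2 (λ c δ →
      c :* δ :+ (δ :+ δ) := (con 1ℚ :+ c) :* δ :+ δ :* con 1ℚ) refl c δ ⟩
    (1ℚ ℚ.+ c) ℚ.* δ ℚ.+ δ ℚ.* 1ℚ ≡⟨ eq ⟩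
    ε                             ∎
  where
  open ℚₚ.≤-Reasoning
  open ℚSolver.+-*-Solver

small-sum : ∀ (s : Fin k → ℕ → ℚ) → (∀ i → Small (s i)) → Small (λ t → sum (λ i → s i t))
small-sum {zero}  s _   = λ ε 0<ε → 0 , λ _ _ → ℚₚ.<⇒≤ 0<ε
small-sum {suc k} s s≤0 = small-+ (s≤0 zero) (small-sum (s ∘ suc) (s≤0 ∘ suc))

¬small-1 : ¬ Small (λ _ → 1ℚ)
¬small-1 1≤0 with M , p ← 1≤0 ½ (ℚₚ.positive⁻¹ ½) = toWitnessFalse {a? = 1ℚ ℚ.≤? ½} _ (p M ℕₚ.≤-refl)

null⇒small : ∀ {s} → Null s → Small s
null⇒small {s} = small-≤ λ t → p≤∣p∣ (s t)
  where
  p≤∣p∣ : ∀ p → p ℚ.≤ ℚ.∣ p ∣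
  p≤∣p∣ p with ℚₚ.≤-total 0ℚ p
  ... | inj₁ 0≤p = ℚₚ.≤-reflexive (sym (ℚₚ.0≤p⇒∣p∣≡p 0≤p))
  ... | inj₂ p≤0 = ℚₚ.≤-trans p≤0 (ℚₚ.0≤∣p∣ p)

null-+ : ∀ {r s} → Null r → Null s → Null (λ t → r t ℚ.+ s t)
null-+ {r} {s} r→0 s→0 = small-≤ (λ t → ℚₚ.∣p+q∣≤∣p∣+∣q∣ (r t) (s t)) (small-+ r→0 s→0)

null-* : ∀ c {s} → Null s → Null (λ t → c ℚ.* s t)
null-* c {s} s→0 = small-≤ (λ t → ℚₚ.≤-reflexive (ℚₚ.∣p*q∣≡∣p∣*∣q∣ c (s t)))
  (small-* ℚ.∣ c ∣ (ℚₚ.∣-∣-nonNeg c) s→0)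

null-≗ : ∀ {r s} → (∀ t → r t ≡ s t) → Null s → Null r
null-≗ r≗s = small-≤ λ t → ℚₚ.≤-reflexive (cong ℚ.∣_∣ (r≗s t))

-- Finite sums, and additive functionals as linear forms

sum-linear : ∀ a (x y : Vector ℚ k) → sum (λ i → a ℚ.* x i ℚ.+ y i) ≡ a ℚ.* sum x ℚ.+ sum y
sum-linear a x y = trans (∑-distrib-+ (λ i → a ℚ.* x i) y) (cong (ℚ._+ sum y) (sym (*-distribˡ-sum a x)))

seq-∑ : ∀ (x : Vector ℝ k) t → seq (∑ x) t ≡ sum (λ i → seq (x i) t)
seq-∑ {zero}  x t = refl
seq-∑ {suc k} x t = cong (λ y → seq (x zero) t ℚ.+ y) (seq-∑ (x ∘ suc) t)

zeros : ∀ n → ℤ^ n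
zeros n = replicate n 0ℤ

⊕-identityˡ : (x : ℤ^ n) → zeros n ⊕ x ≡ x
⊕-identityˡ []       = refl
⊕-identityˡ (x ∷ xs) = cong₂ _∷_ (ℤₚ.+-identityˡ x) (⊕-identityˡ xs)

additive-zeros : (f : ℤ^ n → ℤ) → Additive f → f (zeros n) ≡ 0ℤ
additive-zeros {n} f f+ = +-cancelʳ (f (zeros n)) _ _ (begin
  f (zeros n) ℤ.+ f (zeros n) ≡⟨ f+ _ _ ⟨
  f (zeros n ⊕ zeros n)       ≡⟨ cong f (⊕-identityˡ (zeros n)) ⟩
  f (zeros n)                 ≡⟨ ℤₚ.+-identityˡ _ ⟨
  0ℤ ℤ.+ f (zeros n)          ∎)
  where open ≡-Reasoning

-- Induction gives the nonnegative arguments; for a negative one, the value at the opposite integer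
-- is cancelled.
additive-ℤ : (g : ℤ → ℤ) → (∀ x y → g (x ℤ.+ y) ≡ g x ℤ.+ g y) → ∀ x → g x ≡ g 1ℤ ℤ.* x
additive-ℤ g g+ = λ where
    (+ m)      → nonNeg m
    -[1+ m ]   → +-cancelʳ (g (+ suc m)) _ _ (begin
      g -[1+ m ] ℤ.+ g (+ suc m)                 ≡⟨ g+ _ _ ⟨
      g (-[1+ m ] ℤ.+ + suc m)                   ≡⟨ cong g (ℤₚ.+-inverseˡ (+ suc m)) ⟩
      g 0ℤ                                       ≡⟨ g0 ⟩
      0ℤ                                         ≡⟨ ℤₚ.*-zeroʳ (g 1ℤ) ⟨
      g 1ℤ ℤ.* 0ℤ                                ≡⟨ cong (λ y → g 1ℤ ℤ.* y) (ℤₚ.+-inverseˡ (+ suc m)) ⟨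
      g 1ℤ ℤ.* (-[1+ m ] ℤ.+ + suc m)            ≡⟨ ℤₚ.*-distribˡ-+ (g 1ℤ) -[1+ m ] (+ suc m) ⟩
      g 1ℤ ℤ.* -[1+ m ] ℤ.+ g 1ℤ ℤ.* (+ suc m)   ≡⟨ cong (λ y → g 1ℤ ℤ.* -[1+ m ] ℤ.+ y) (nonNeg (suc m)) ⟨
      g 1ℤ ℤ.* -[1+ m ] ℤ.+ g (+ suc m)          ∎)
  where
  open ≡-Reasoning
  g0 : g 0ℤ ≡ 0ℤ
  g0 = +-cancelʳ (g 0ℤ) _ _ (trans (sym (g+ 0ℤ 0ℤ)) (sym (ℤₚ.+-identityˡ (g 0ℤ))))
  nonNeg : ∀ m → g (+ m) ≡ g 1ℤ ℤ.* + m
  nonNeg zero    = trans g0 (sym (ℤₚ.*-zeroʳ (g 1ℤ)))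
  nonNeg (suc m) = trans (g+ 1ℤ (+ m)) (trans (cong (λ y → g 1ℤ ℤ.+ y) (nonNeg m)) (sym (ℤₚ.*-suc (g 1ℤ) (+ m))))

-- Splits off the first coordinate with the value of `f` at the first basis vector as coefficient,
-- so that linearity follows by recursion on the dimension.
additive-∷ : (f : ℤ^ (suc n) → ℤ) → Additive f → ∀ x →
  f x ≡ f (1ℤ ∷ zeros n) ℤ.* lookup x zero ℤ.+ f (0ℤ ∷ tail x)
additive-∷ {n} f f+ (x ∷ xs) = begin
  f (x ∷ xs)
    ≡⟨ cong₂ (λ y ys → f (y ∷ ys)) (ℤₚ.+-identityʳ x) (⊕-identityˡ xs) ⟨
  f (x ℤ.+ 0ℤ ∷ zeros n ⊕ xs)
    ≡⟨ f+ _ _ ⟩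
  f (x ∷ zeros n) ℤ.+ f (0ℤ ∷ xs)
    ≡⟨ cong (ℤ._+ f (0ℤ ∷ xs)) (additive-ℤ (λ x → f (x ∷ zeros n)) along x) ⟩
  f (1ℤ ∷ zeros n) ℤ.* x ℤ.+ f (0ℤ ∷ xs) ∎
  where
  open ≡-Reasoning
  along : ∀ x y → f (x ℤ.+ y ∷ zeros n) ≡ f (x ∷ zeros n) ℤ.+ f (y ∷ zeros n)
  along x y = trans (cong (λ z → f (x ℤ.+ y ∷ z)) (sym (⊕-identityˡ (zeros n)))) (f+ _ _)

-- From coordinates to additive functionals of a convex combination

module _ (W : Fin k → ℕ → ℚ) where

  -- The error at stage `t` in writing `a` as the combination of the `b i` with approximate weights
  -- `W i t`. Hull membership makes this error tend to 0 in each coordinate.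
  defect : ℤ → (Fin k → ℤ) → ℕ → ℚ
  defect a b t = toℚ a ℚ.- sum (λ i → W i t ℚ.* toℚ (b i))

  defect-linear : ∀ c {a₁ a₂ a b₁ b₂ b} → a ≡ c ℤ.* a₁ ℤ.+ a₂ → (∀ i → b i ≡ c ℤ.* b₁ i ℤ.+ b₂ i) →
    ∀ t → defect a b t ≡ toℚ c ℚ.* defect a₁ b₁ t ℚ.+ defect a₂ b₂ t
  defect-linear c {a₁} {a₂} {a} {b₁} {b₂} {b} eq eqs t = begin
    toℚ a ℚ.- sum (λ i → W i t ℚ.* toℚ (b i))
      ≡⟨ cong₂ ℚ._-_ (split eq) (trans (sum-cong-≗ step)
           (sum-linear (toℚ c) (λ i → W i t ℚ.* toℚ (b₁ i)) (λ i → W i t ℚ.* toℚ (b₂ i)))) ⟩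
    (toℚ c ℚ.* toℚ a₁ ℚ.+ toℚ a₂) ℚ.- (toℚ c ℚ.* S₁ ℚ.+ S₂)
      ≡⟨ solve 5 (λ c x y s t → (c :* x :+ y) :- (c :* s :+ t) := c :* (x :- s) :+ (y :- t)) refl
           (toℚ c) (toℚ a₁) (toℚ a₂) S₁ S₂ ⟩
    toℚ c ℚ.* (toℚ a₁ ℚ.- S₁) ℚ.+ (toℚ a₂ ℚ.- S₂) ∎
    where
    open ≡-Reasoning
    open ℚSolver.+-*-Solver
    S₁ S₂ : ℚ
    S₁ = sum (λ i → W i t ℚ.* toℚ (b₁ i))
    S₂ = sum (λ i → W i t ℚ.* toℚ (b₂ i))
    split : ∀ {x y z} → x ≡ c ℤ.* y ℤ.+ z → toℚ x ≡ toℚ c ℚ.* toℚ y ℚ.+ toℚ z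
    split {y = y} {z} refl = trans (toℚ-+ (c ℤ.* y) z) (cong (ℚ._+ toℚ z) (toℚ-* c y))
    step : ∀ i → W i t ℚ.* toℚ (b i) ≡ toℚ c ℚ.* (W i t ℚ.* toℚ (b₁ i)) ℚ.+ W i t ℚ.* toℚ (b₂ i)
    step i = trans (cong (λ y → W i t ℚ.* y) (split (eqs i)))
      (solve 4 (λ w c x y → w :* (c :* x :+ y) := c :* (w :* x) :+ w :* y) refl
        (W i t) (toℚ c) (toℚ (b₁ i)) (toℚ (b₂ i)))

  defect-zero : ∀ {a b} → a ≡ 0ℤ → (∀ i → b i ≡ 0ℤ) → Null (defect a b)
  defect-zero {a} {b} a≡0 b≡0 ε 0<ε = 0 , λ t _ →
    ℚₚ.≤-trans (ℚₚ.≤-reflexive (cong ℚ.∣_∣ (vanish t))) (ℚₚ.<⇒≤ 0<ε)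
    where
    open ≡-Reasoning
    vanish : ∀ t → defect a b t ≡ 0ℚ
    vanish t = cong₂ (λ x y → toℚ x ℚ.- y) a≡0 (begin
      sum (λ i → W i t ℚ.* toℚ (b i)) ≡⟨ sum-cong-≗ (λ i → cong (λ y → W i t ℚ.* toℚ y) (b≡0 i)) ⟩
      sum (λ i → W i t ℚ.* 0ℚ)        ≡⟨ *-distribʳ-sum 0ℚ (λ i → W i t) ⟨
      sum (λ i → W i t) ℚ.* 0ℚ        ≡⟨ ℚₚ.*-zeroʳ (sum (λ i → W i t)) ⟩
      0ℚ                              ∎)

  -- By `additive-∷` the defect of `f` is a fixed multiple of the defect of the first coordinate
  -- plus the defect of `f` on the remaining coordinates.
  defect-additive : (f : ℤ^ n → ℤ) → Additive f → (z : ℤ^ n) (p : Vector (ℤ^ n) k) →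
    (∀ c → Null (defect (lookup z c) (λ i → lookup (p i) c))) → Null (defect (f z) (f ∘ p))
  defect-additive {zero}  f f+ z p z≈wp = defect-zero (vanish z) (λ i → vanish (p i))
    where
    vanish : ∀ x → f x ≡ 0ℤ
    vanish [] = additive-zeros f f+
  defect-additive {suc n} f f+ z p z≈wp =
    null-≗ (defect-linear (f (1ℤ ∷ zeros n)) (additive-∷ f f+ z) (λ i → additive-∷ f f+ (p i)))
      (null-+ (null-* (toℚ (f (1ℤ ∷ zeros n))) (z≈wp zero))
        (defect-additive (f ∘ (0ℤ ∷_)) (λ x y → f+ (0ℤ ∷ x) (0ℤ ∷ y)) (tail z) (tail ∘ p) tails))
    where
    lookup-tail : ∀ c (x : ℤ^ (suc n)) → lookup (tail x) c ≡ lookup x (suc c)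
    lookup-tail c (_ ∷ _) = refl
    tails : ∀ c → Null (defect (lookup (tail z) c) (λ i → lookup (tail (p i)) c))
    tails c = null-≗ (λ t → cong₂ (λ x y → toℚ x ℚ.- y) (lookup-tail c z)
        (sum-cong-≗ λ i → cong (λ y → W i t ℚ.* toℚ y) (lookup-tail c (p i))))
      (z≈wp (suc c))

-- Separated points lie outside the hull

positive-gap : ∀ {i j} → i ℤ.< j → ∃ λ m → j ≡ i ℤ.+ + suc m
positive-gap {i} {j} i<j = ℤ.∣ j ℤ.- ℤ.suc i ∣ , sym (begin
  i ℤ.+ (1ℤ ℤ.+ + ℤ.∣ j ℤ.- ℤ.suc i ∣) ≡⟨ cong (λ d → i ℤ.+ (1ℤ ℤ.+ d)) (ℤₚ.0≤i⇒+∣i∣≡i 0≤j-suc[i]) ⟩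
  i ℤ.+ (1ℤ ℤ.+ (j ℤ.- (1ℤ ℤ.+ i)))    ≡⟨ solve 2 (λ i j → i :+ (con 1ℤ :+ (j :- (con 1ℤ :+ i))) := j) refl i j ⟩
  j                                    ∎)
  where
  open ≡-Reasoning
  open ℤSolver.+-*-Solver
  0≤j-suc[i] = ℤₚ.i≤j⇒0≤j-i (ℤₚ.i<j⇒suc[i]≤j i<j)

-- In the hull, `f z` would be a weighted mean of the values `f (p i)`, each at most `f z` minus 1,
-- which would give 1 ≤ 0. For sequences: the constant 1 would be a sum of sequences with
-- nonpositive upper limit.
separates⇒∉hull : ∀ f (p : Vector (ℤ^ n) k) z → Separates f p z → ¬ (ι z ∈ convexHull (map ι p))
separates⇒∉hull {k = k} f p z (f+ , fp<fz) (w , comb) = ¬small-1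
  (small-≤ (λ t → ℚₚ.≤-reflexive (identity t))
    (small-+ (null⇒small (null-+ Δ→0 (null-* (F ℚ.- 1ℚ) σ→0)))
      (small-sum (λ i t → toℚ (+ gap i) ℚ.* (ℚ.- W i t))
        (λ i → small-* (toℚ (+ gap i)) (ℚₚ.normalize-nonNeg (gap i) 1) (-w≤0 i)))))
  where
  open IsConvexCombination comb
  open ℚSolver.+-*-Solver

  W : Fin k → ℕ → ℚ
  W i t = seq (w i) t

  F : ℚ
  F = toℚ (f z)

  gap : Fin k → ℕ
  gap i = proj₁ (positive-gap (fp<fz i))

  σ Δ R : ℕ → ℚ
  σ t = sum (λ i → W i t) ℚ.- 1ℚ
  Δ = defect W (f z) (f ∘ p)
  R t = sum (λ i → toℚ (+ gap i) ℚ.* (ℚ.- W i t))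

  -w≤0 : ∀ i → Small (λ t → ℚ.- W i t)
  -w≤0 i ε 0<ε with M , q ← nonNegative i ε 0<ε = M , λ t M≤t →
    subst₂ ℚ._≤_ (ℚₚ.+-identityˡ (ℚ.- W i t)) (solve 2 (λ w e → w :+ e :- w := e) refl (W i t) ε)
      (ℚₚ.+-monoˡ-≤ (ℚ.- W i t) (q t M≤t))

  σ→0 : Null σ
  σ→0 ε 0<ε with M , q ← sumsToOne ε 0<ε = M , λ t M≤t →
    subst (ℚ._≤ ε) (cong (λ y → ℚ.∣ y ℚ.- 1ℚ ∣) (seq-∑ w t)) (q t M≤t)

  Δ→0 : Null Δ
  Δ→0 = defect-additive W f f+ z p λ c ε 0<ε → let M , q = combination c ε 0<ε in
    M , λ t M≤t → subst (ℚ._≤ ε)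
      (cong (λ y → ℚ.∣ toℚ (lookup z c) ℚ.- y ∣) (seq-∑ (λ i → w i * fromℤ (lookup (p i) c)) t))
      (q t M≤t)

  value : ∀ i → toℚ (f (p i)) ≡ F ℚ.- 1ℚ ℚ.- toℚ (+ gap i)
  value i = begin
    P                                       ≡⟨ solve 2 (λ P g → P := P :+ (con 1ℚ :+ g) :- con 1ℚ :- g) refl P g ⟩
    P ℚ.+ (1ℚ ℚ.+ g) ℚ.- 1ℚ ℚ.- g           ≡⟨ cong (λ y → P ℚ.+ y ℚ.- 1ℚ ℚ.- g) (toℚ-+ 1ℤ (+ gap i)) ⟨
    P ℚ.+ toℚ (+ suc (gap i)) ℚ.- 1ℚ ℚ.- g  ≡⟨ cong (λ y → y ℚ.- 1ℚ ℚ.- g) (toℚ-+ (f (p i)) (+ suc (gap i))) ⟨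
    toℚ (f (p i) ℤ.+ + suc (gap i)) ℚ.- 1ℚ ℚ.- g
      ≡⟨ cong (λ y → toℚ y ℚ.- 1ℚ ℚ.- g) (proj₂ (positive-gap (fp<fz i))) ⟨
    F ℚ.- 1ℚ ℚ.- g                          ∎
    where
    open ≡-Reasoning
    P = toℚ (f (p i))
    g = toℚ (+ gap i)

  -- Since f z − f (p i) = 1 + gap i, the constant 1 is made of the null sequences σ and Δ
  -- and of nonnegative multiples of the −W i.
  identity : ∀ t → 1ℚ ≡ Δ t ℚ.+ (F ℚ.- 1ℚ) ℚ.* σ t ℚ.+ R t
  identity t = sym (begin
    Δ t ℚ.+ (F ℚ.- 1ℚ) ℚ.* σ t ℚ.+ R t
      ≡⟨ cong (λ y → F ℚ.- y ℚ.+ (F ℚ.- 1ℚ) ℚ.* σ t ℚ.+ R t) (trans (sum-cong-≗ step)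
           (sum-linear (F ℚ.- 1ℚ) (λ i → W i t) (λ i → toℚ (+ gap i) ℚ.* (ℚ.- W i t)))) ⟩
    F ℚ.- ((F ℚ.- 1ℚ) ℚ.* T ℚ.+ R t) ℚ.+ (F ℚ.- 1ℚ) ℚ.* (T ℚ.- 1ℚ) ℚ.+ R t
      ≡⟨ solve 3 (λ F T R → F :- ((F :- con 1ℚ) :* T :+ R) :+ (F :- con 1ℚ) :* (T :- con 1ℚ) :+ R := con 1ℚ)
           refl F T (R t) ⟩
    1ℚ ∎)
    where
    open ≡-Reasoning
    T : ℚ
    T = sum (λ i → W i t)
    step : ∀ i → W i t ℚ.* toℚ (f (p i)) ≡ (F ℚ.- 1ℚ) ℚ.* W i t ℚ.+ toℚ (+ gap i) ℚ.* (ℚ.- W i t)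
    step i = trans (cong (λ y → W i t ℚ.* y) (value i))
      (solve 3 (λ w F g → w :* (F :- con 1ℚ :- g) := (F :- con 1ℚ) :* w :+ g :* (:- w)) refl
        (W i t) F (toℚ (+ gap i)))

-- Kronecker delta weights: each generator lies in its hull

unit : Fin k → Fin k → ℚ
unit zero    zero    = 1ℚ
unit zero    (suc _) = 0ℚ
unit (suc _) zero    = 0ℚ
unit (suc i) (suc j) = unit i j

0≤unit : ∀ (i j : Fin k) → 0ℚ ℚ.≤ unit i j
0≤unit zero    zero    = ℚₚ.<⇒≤ (ℚₚ.positive⁻¹ 1ℚ)
0≤unit zero    (suc _) = ℚₚ.≤-refl
0≤unit (suc _) zero    = ℚₚ.≤-refl
0≤unit (suc i) (suc j) = 0≤unit i j

sum-unit : ∀ i (x : Vector ℚ k) → sum (λ j → unit i j ℚ.* x j) ≡ x i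
sum-unit zero x = begin
  1ℚ ℚ.* x zero ℚ.+ sum (λ j → 0ℚ ℚ.* x (suc j))
    ≡⟨ cong (λ y → 1ℚ ℚ.* x zero ℚ.+ y) (*-distribˡ-sum 0ℚ (x ∘ suc)) ⟨
  1ℚ ℚ.* x zero ℚ.+ 0ℚ ℚ.* sum (x ∘ suc)
    ≡⟨ solve 2 (λ a b → con 1ℚ :* a :+ con 0ℚ :* b := a) refl (x zero) (sum (x ∘ suc)) ⟩
  x zero ∎
  where
  open ≡-Reasoning
  open ℚSolver.+-*-Solver
sum-unit (suc i) x = trans (cong₂ ℚ._+_ (ℚₚ.*-zeroˡ (x zero)) (sum-unit i (x ∘ suc))) (ℚₚ.+-identityˡ _)

≗⇒≈ : ∀ x y → (∀ t → seq x t ≡ seq y t) → x ≈ y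
≗⇒≈ x y eq ε 0<ε = 0 , λ t _ → subst (λ r → ℚ.∣ r ∣ ℚ.≤ ε)
  (sym (trans (cong (ℚ._- seq y t) (eq t)) (ℚₚ.+-inverseʳ (seq y t)))) (ℚₚ.<⇒≤ 0<ε)

vertex∈hull : ∀ (p : Vector (ℝ^ n) k) i → p i ∈ convexHull p
vertex∈hull p i = (λ j → fromℚ (unit i j)) , record
  { nonNegative = λ j ε 0<ε → 0 , λ _ _ → ℚₚ.+-mono-≤ (0≤unit i j) (ℚₚ.<⇒≤ 0<ε)
  -- The total weight is `sum-unit` at the constant vector 1.
  ; sumsToOne   = ≗⇒≈ (∑ λ j → fromℚ (unit i j)) 1ℝ λ t → trans (seq-∑ (λ j → fromℚ (unit i j)) t)
      (trans (sum-cong-≗ (λ j → sym (ℚₚ.*-identityʳ (unit i j)))) (sum-unit i (λ _ → 1ℚ)))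
  ; combination = λ c → ≗⇒≈ (p i c) (∑ λ j → fromℚ (unit i j) * p j c) λ t → sym
      (trans (seq-∑ (λ j → fromℚ (unit i j) * p j c) t) (sum-unit i (λ j → seq (p j c) t)))
  }

theorem3 : (n : ℕ) → n ≥ 1 →
    Σ[ P ∈ Pred (ℝ^ n) 0ℓ ] Σ[ dps ∈ IsDPSPolytope P ] IsMaximal dps
theorem3 n _ = convexHull (map ι points) , record
  -- The polytope is by definition the hull of `points`, so both inclusions are the identity.
  { isLatticePolytope = size , points , id , id
  ; N                 = size
  ; v                 = points
  ; enumerates        = record
      { injective = dps⇒injective dps
      ; complete  = λ z → mk⇔ (∈hull⇒point z) λ { (i , refl) → vertex∈hull (map ι points) i }
      }
  ; distinctPairSums  = dps
  } , size≡2^n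
  where
  open Configuration (configuration n)
  ∈hull⇒point : ∀ z → ι z ∈ convexHull (map ι points) → ∃ λ i → points i ≡ z
  ∈hull⇒point z z∈P with separated z
  ... | inj₁ found     = found
  ... | inj₂ (f , sep) = ⊥-elim (separates⇒∉hull f points z sep z∈P)
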